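{- For $n\in\{0,1,2,\dots\}$ let \[ b_n=\frac14\frac{(-1)^n}{n!}\sum_{k=0}^{n}(-1)^kS(n,k)(2k-1)!!,\qquad d_n=\frac{(-1)^n}{n!}\sum_{k=0}^{n}(-1)^kS(n,k)(2k-3)!!, \] so that $d_0=-1$, $d_1=1$, $d_2=0$, $d_3=\frac16$, $b_0=b_1=b_2=\frac14$, and $b_3=\frac7{24}$. For $n\in\mathbb{N}$ let $D^{(n)}=(D_{ij})_{1\le i,j\le n}$ be the $n\times n$ matrix with $D_{ij}=d_{i-j+1}$ if $j\le i$, $D_{i,i+1}=-1$, and $D_{ij}=0$ if $j\ge i+2$. Let $B^{(n)}=(B_{ij})_{1\le i,j\le n}$ be the $n\times n$ matrix with $B_{ij}=b_{i-j+1}$ if $j\le i+1$ and $B_{ij}=0$ if $j\ge i+2$. Then for every $n\in\mathbb{N}$, \[ b_n=\frac14\det D^{(n)}\qquad\text{and}\qquad d_n=(-1)^{n-1}4^n\det B^{(n)}. \]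
   Context: $S(n,k)$ are the Stirling numbers of the second kind, given by $\frac{(e^x-1)^k}{k!}=\sum_{n\ge k}S(n,k)\frac{x^n}{n!}$. Double factorials: $(2j-1)!!=1\cdot3\cdots(2j-1)$ for $j\ge1$, and $[-(2j+1)]!!=(-1)^j/(2j-1)!!$ for $j\ge0$, so $(-1)!!=1$ and $(-3)!!=-1$. -}

module Defs where

open import Algebra.Bundles using (CommutativeRing)
open import Data.Bool.Base using (if_then_else_)
open import Data.Fin.Base using (Fin; zero; suc; toℕ; punchIn)
open import Data.Integer.Base as ℤ using (ℤ; +_; -[1+_])
open import Data.Nat.Base as ℕ using (ℕ; zero; suc; _∸_; _≤ᵇ_; _≡ᵇ_; _!)
open import Data.Nat.Properties as ℕ using (_!≢0)
open import Data.Rational.Base using (ℚ; 0ℚ; 1ℚ; _/_; _+_; _*_; _-_; -_)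
open import Data.Rational.Properties using (+-*-commutativeRing)
open import Data.Vec.Functional using (Vector)
open import Relation.Binary.PropositionalEquality.Core using (_≡_; refl)

open CommutativeRing +-*-commutativeRing using (semiring)
open import Algebra.Properties.Semiring.Sum semiring public
  using (sum; sum-syntax)
open import Algebra.Properties.Semiring.Exp semiring public
  using (_^_)

-- The sum over k = 0, …, n (both ends included).

∑₀ : ℕ → (ℕ → ℚ) → ℚ
∑₀ n f = ∑[ k < suc n ] f (toℕ k)

1/_! : ℕ → ℚ
1/ n ! = (+ 1 / n !) {{n !≢0}}

-- Formal power series over ℚ; f n is the coefficient of xⁿ.

PowerSeries : Set
PowerSeries = ℕ → ℚ

one : PowerSeries
one zero    = 1ℚ
one (suc _) = 0ℚ

exp : PowerSeries
exp n = 1/ n !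

_⊖_ : PowerSeries → PowerSeries → PowerSeries
(f ⊖ g) n = f n - g n

_⊛_ : PowerSeries → PowerSeries → PowerSeries
(f ⊛ g) n = ∑₀ n λ k → f k * g (n ∸ k)

_⊛^_ : PowerSeries → ℕ → PowerSeries
f ⊛^ zero  = one
f ⊛^ suc k = f ⊛ (f ⊛^ k)

-- Stirling numbers of the second kind, as rationals.  Comparing coefficients
-- of xⁿ in (eˣ − 1)ᵏ / k! = Σ S(n,k) xⁿ / n! gives
-- S(n,k) = n! · [xⁿ] (eˣ − 1)ᵏ / k!.

S : ℕ → ℕ → ℚ
S n k = (+ (n !) / 1) * (((exp ⊖ one) ⊛^ k) n * 1/ k !)

-- 1 · 3 ⋯ (2j − 1)

oddProduct : ℕ → ℕ
oddProduct zero    = 1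
oddProduct (suc j) = oddProduct j ℕ.* (2 ℕ.* j ℕ.+ 1)

oddProduct≢0 : ∀ j → ℕ.NonZero (oddProduct j)
oddProduct≢0 zero    = _
oddProduct≢0 (suc j) = ℕ.m*n≢0 (oddProduct j) (2 ℕ.* j ℕ.+ 1)
  {{oddProduct≢0 j}} {{ℕ.≢-nonZero (ℕ.m+1+n≢0 (2 ℕ.* j))}}

-- Double factorials of odd integers: [2 j -1]!! is (2j − 1)!! for any integer
-- j.  At j = −(1 + i) the argument is 2j − 1 = −(2(i + 1) + 1), and
-- [−(2m + 1)]!! = (−1)ᵐ / (2m − 1)!!.

[2_-1]!! : ℤ → ℚ
[2 + j      -1]!! = + oddProduct j / 1
[2 -[1+ i ] -1]!! =
  (- 1ℚ) ^ suc i * (+ 1 / oddProduct (suc i)) {{oddProduct≢0 (suc i)}}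

b : ℕ → ℚ
b n = (+ 1 / 4) * ((- 1ℚ) ^ n * 1/ n !)
    * ∑₀ n (λ k → (- 1ℚ) ^ k * S n k * [2 + k -1]!!)

-- (2k − 3)!! = (2(k − 1) − 1)!!

d : ℕ → ℚ
d n = (- 1ℚ) ^ n * 1/ n !
    * ∑₀ n (λ k → (- 1ℚ) ^ k * S n k * [2 + k ℤ.- + 1 -1]!!)

Matrix : ℕ → Set
Matrix n = Fin n → Fin n → ℚ

-- Determinant, by Laplace expansion along the first row.

det : ∀ {n} → Matrix n → ℚ
det {zero}  A = 1ℚ
det {suc n} A =
  ∑[ j < suc n ] ((- 1ℚ) ^ toℕ j * A zero j * det λ i k → A (suc i) (punchIn j k))

-- Fin n numbers rows and columns from 0 instead of 1; the entries below depend
-- only on i − j, so the shift is immaterial.  Each ∸ is used only where it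
-- agrees with integer subtraction.

D : ∀ n → Matrix n
D n i j =
  if toℕ j ≤ᵇ toℕ i then d (suc (toℕ i ∸ toℕ j))
  else if toℕ j ≡ᵇ suc (toℕ i) then - 1ℚ
  else 0ℚ

B : ∀ n → Matrix n
B n i j =
  if toℕ j ≤ᵇ suc (toℕ i) then b (suc (toℕ i) ∸ toℕ j)
  else 0ℚ

d₀ : d 0 ≡ - 1ℚ
d₀ = refl

d₁ : d 1 ≡ 1ℚ
d₁ = refl

d₂ : d 2 ≡ 0ℚ
d₂ = refl

d₃ : d 3 ≡ + 1 / 6
d₃ = refl

b₀ : b 0 ≡ + 1 / 4
b₀ = refl

b₁ : b 1 ≡ + 1 / 4
b₁ = refl

b₂ : b 2 ≡ + 1 / 4
b₂ = refl

b₃ : b 3 ≡ + 7 / 24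
b₃ = refl

{-# OPTIONS --safe #-}
module Submission where

-- Up to the substitution x ↦ −x, the series 4 Σ bₙ xⁿ and Σ dₙ xⁿ are
-- (1 + 2t)^(−1/2) and −(1 + 2t)^(1/2) at t = eˣ − 1, so their product is −1.
-- The product identity in t follows from the differential equations of the two
-- factors, and composition with eˣ − 1 is multiplicative.  Since d₀ = −1, both
-- D and B are Toeplitz–Hessenberg matrices (a_{i−j+1}), with a = d and a = b; the
-- Laplace expansion of such determinants is the recursion that determines the
-- coefficients of the inverse series of a.

open import Defs
open import Algebra.Bundles using (CommutativeRing)
open import Data.Bool.Base using (if_then_else_)
open import Data.Fin.Base using (Fin; zero; suc; toℕ; punchIn)
open import Data.Integer.Base as ℤ using (+_)
import Data.Integer.Properties as ℤ
open import Data.Nat.Base as ℕ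
  using (ℕ; zero; suc; _∸_; _≤_; _<_; z≤n; s≤s; _≤ᵇ_; _≡ᵇ_; _!)
import Data.Nat.Properties as ℕ
open import Data.Product.Base using (_×_; _,_)
open import Data.Rational.Base
  using (ℚ; 0ℚ; 1ℚ; _/_; _+_; _*_; -_; fromℚᵘ)
open import Data.Rational.Properties
open import Data.Rational.Solver using (module +-*-Solver)
import Data.Rational.Unnormalised.Base as ℚᵘ
import Data.Rational.Unnormalised.Properties as ℚᵘ
open import Function.Base using (_∘_)
open import Relation.Binary.PropositionalEquality
  using (_≡_; _≗_; refl; sym; trans; cong; cong₂; module ≡-Reasoning)

open CommutativeRing +-*-commutativeRing using (semiring)
open import Algebra.Properties.Semiring.Sum semiring
  using (sum-cong-≗; sum-replicate-zero; ∑-distrib-+; *-distribˡ-sum)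
open +-*-Solver
open ≡-Reasoning

private variable
  f f′ g g′ : PowerSeries

-- Finite sums and the Cauchy product.

∑₀-cong : ∀ n → f ≗ g → ∑₀ n f ≡ ∑₀ n g
∑₀-cong n eq = sum-cong-≗ {suc n} (eq ∘ toℕ)

∑₀-distrib-+ : ∀ n f g → ∑₀ n (λ k → f k + g k) ≡ ∑₀ n f + ∑₀ n g
∑₀-distrib-+ n f g = ∑-distrib-+ {suc n} (f ∘ toℕ) (g ∘ toℕ)

*-distribˡ-∑₀ : ∀ n r f → r * ∑₀ n f ≡ ∑₀ n (λ k → r * f k)
*-distribˡ-∑₀ n r f = *-distribˡ-sum {suc n} r (f ∘ toℕ)

∑₀-zero : ∀ n {f : ℕ → ℚ} → (∀ k → f k ≡ 0ℚ) → ∑₀ n f ≡ 0ℚ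
∑₀-zero n eq = trans (∑₀-cong n eq) (sum-replicate-zero (suc n))

∑₀-truncate : ∀ {m n} → m ≤ n → (f : ℕ → ℚ) → (∀ k → m < k → f k ≡ 0ℚ) →
  ∑₀ n f ≡ ∑₀ m f
∑₀-truncate {n = zero}  z≤n       f eq = refl
∑₀-truncate {n = suc n} z≤n       f eq =
  cong (λ x → f 0 + x) (∑₀-zero n λ k → eq (suc k) (s≤s z≤n))
∑₀-truncate             (s≤s m≤n) f eq =
  cong (λ x → f 0 + x) (∑₀-truncate m≤n (f ∘ suc) λ k m<k → eq (suc k) (s≤s m<k))

-- The inductions on coefficients below use that, definitionally,
-- (f ⊛ g) (suc n) = f 0 * g (suc n) + ((f ∘ suc) ⊛ g) n.

⊛-congˡ-≤ : ∀ f n → (∀ i → i ≤ n → g i ≡ g′ i) → (f ⊛ g) n ≡ (f ⊛ g′) n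
⊛-congˡ-≤ f n eq =
  sum-cong-≗ {suc n} λ k → cong (f (toℕ k) *_) (eq (n ∸ toℕ k) (ℕ.m∸n≤m n (toℕ k)))

⊛-congˡ : ∀ f → g ≗ g′ → ∀ n → (f ⊛ g) n ≡ (f ⊛ g′) n
⊛-congˡ f eq n = ⊛-congˡ-≤ f n λ i _ → eq i

⊛-congʳ : ∀ g → f ≗ f′ → ∀ n → (f ⊛ g) n ≡ (f′ ⊛ g) n
⊛-congʳ g eq n = ∑₀-cong n λ k → cong (_* g (n ∸ k)) (eq k)

⊛-distribʳ-+ : ∀ f g h n → ((λ k → f k + g k) ⊛ h) n ≡ (f ⊛ h) n + (g ⊛ h) n
⊛-distribʳ-+ f g h n = trans
  (∑₀-cong n λ k → *-distribʳ-+ (h (n ∸ k)) (f k) (g k))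
  (∑₀-distrib-+ n (λ k → f k * h (n ∸ k)) (λ k → g k * h (n ∸ k)))

*-⊛ : ∀ r f g n → ((λ k → r * f k) ⊛ g) n ≡ r * (f ⊛ g) n
*-⊛ r f g n = trans
  (∑₀-cong n λ k → *-assoc r (f k) (g (n ∸ k)))
  (sym (*-distribˡ-∑₀ n r λ k → f k * g (n ∸ k)))

⊛-zeroˡ : ∀ f n → ((λ _ → 0ℚ) ⊛ f) n ≡ 0ℚ
⊛-zeroˡ f n = trans (*-⊛ 0ℚ (λ _ → 0ℚ) f n) (*-zeroˡ (((λ _ → 0ℚ) ⊛ f) n))

-- Splits off the last term of the convolution where the definition splits off the first;
-- commutativity follows by playing the two recursions against each other.
⊛-sucʳ : ∀ f g n → (f ⊛ g) (suc n) ≡ (f ⊛ (g ∘ suc)) n + f (suc n) * g 0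
⊛-sucʳ f g zero = solve 2 (λ x y → x :+ (y :+ con 0ℚ) := x :+ con 0ℚ :+ y) refl
  (f 0 * g 1) (f 1 * g 0)
⊛-sucʳ f g (suc n) = trans
  (cong (λ x → f 0 * g (suc (suc n)) + x) (⊛-sucʳ (f ∘ suc) g n))
  (sym (+-assoc (f 0 * g (suc (suc n))) _ _))

⊛-comm : ∀ f g n → (f ⊛ g) n ≡ (g ⊛ f) n
⊛-comm f g zero = cong (_+ 0ℚ) (*-comm (f 0) (g 0))
⊛-comm f g (suc n) = begin
  f 0 * g (suc n) + ((f ∘ suc) ⊛ g) n
    ≡⟨ cong₂ _+_ (*-comm (f 0) _) (⊛-comm (f ∘ suc) g n) ⟩
  g (suc n) * f 0 + (g ⊛ (f ∘ suc)) n
    ≡⟨ +-comm (g (suc n) * f 0) _ ⟩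
  (g ⊛ (f ∘ suc)) n + g (suc n) * f 0
    ≡⟨ ⊛-sucʳ g f n ⟨
  (g ⊛ f) (suc n) ∎

⊛-assoc : ∀ f g h n → ((f ⊛ g) ⊛ h) n ≡ (f ⊛ (g ⊛ h)) n
⊛-assoc f g h zero = solve 3
  (λ x y z → (x :* y :+ con 0ℚ) :* z :+ con 0ℚ := x :* (y :* z :+ con 0ℚ) :+ con 0ℚ)
  refl (f 0) (g 0) (h 0)
⊛-assoc f g h (suc n) = begin
  (f 0 * g 0 + 0ℚ) * h (suc n) + (((f ⊛ g) ∘ suc) ⊛ h) n
    -- The tail of `f ⊛ g` is definitionally a sum of two series, so distributivity applies.
    ≡⟨ cong (λ x → (f 0 * g 0 + 0ℚ) * h (suc n) + x)
         (⊛-distribʳ-+ (λ k → f 0 * g (suc k)) ((f ∘ suc) ⊛ g) h n) ⟩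
  (f 0 * g 0 + 0ℚ) * h (suc n)
    + (((λ k → f 0 * g (suc k)) ⊛ h) n + (((f ∘ suc) ⊛ g) ⊛ h) n)
    ≡⟨ cong₂ (λ x y → (f 0 * g 0 + 0ℚ) * h (suc n) + (x + y))
         (*-⊛ (f 0) (g ∘ suc) h n) (⊛-assoc (f ∘ suc) g h n) ⟩
  (f 0 * g 0 + 0ℚ) * h (suc n)
    + (f 0 * ((g ∘ suc) ⊛ h) n + ((f ∘ suc) ⊛ (g ⊛ h)) n)
    ≡⟨ solve 5 (λ x y z v w →
         (x :* y :+ con 0ℚ) :* z :+ (x :* v :+ w) := x :* (y :* z :+ v) :+ w) refl
         (f 0) (g 0) (h (suc n)) (((g ∘ suc) ⊛ h) n) (((f ∘ suc) ⊛ (g ⊛ h)) n) ⟩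
  (f ⊛ (g ⊛ h)) (suc n) ∎

⊛-zeroʳ : ∀ f n → (f ⊛ (λ _ → 0ℚ)) n ≡ 0ℚ
⊛-zeroʳ f n = trans (⊛-comm f (λ _ → 0ℚ) n) (⊛-zeroˡ f n)

⊛-linearʳ : ∀ v r f g n →
  (v ⊛ (λ k → r * f k + g k)) n ≡ r * (v ⊛ f) n + (v ⊛ g) n
⊛-linearʳ v r f g n = begin
  (v ⊛ (λ k → r * f k + g k)) n                ≡⟨ ⊛-comm v (λ k → r * f k + g k) n ⟩
  ((λ k → r * f k + g k) ⊛ v) n                ≡⟨ ⊛-distribʳ-+ (λ k → r * f k) g v n ⟩
  ((λ k → r * f k) ⊛ v) n + (g ⊛ v) n
    ≡⟨ cong₂ _+_ (trans (*-⊛ r f v n) (cong (r *_) (⊛-comm f v n))) (⊛-comm g v n) ⟩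
  r * (v ⊛ f) n + (v ⊛ g) n                    ∎

⊛-* : ∀ r f g n → (f ⊛ (λ k → r * g k)) n ≡ r * (f ⊛ g) n
⊛-* r f g n = begin
  (f ⊛ (λ k → r * g k)) n   ≡⟨ ⊛-comm f (λ k → r * g k) n ⟩
  ((λ k → r * g k) ⊛ f) n   ≡⟨ *-⊛ r g f n ⟩
  r * (g ⊛ f) n             ≡⟨ cong (r *_) (⊛-comm g f n) ⟩
  r * (f ⊛ g) n             ∎

⊛-∑ : ∀ {m} v (a : Fin m → ℚ) (s : Fin m → PowerSeries) n →
  (v ⊛ (λ i → ∑[ k < m ] (a k * s k i))) n ≡ ∑[ k < m ] (a k * (v ⊛ s k) n)
⊛-∑ {zero}  v a s n = ⊛-zeroʳ v n
⊛-∑ {suc m} v a s n = trans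
  (⊛-linearʳ v (a zero) (s zero) (λ i → ∑[ k < m ] (a (suc k) * s (suc k) i)) n)
  (cong (λ x → a zero * (v ⊛ s zero) n + x) (⊛-∑ v (a ∘ suc) (s ∘ suc) n))

-- Substitution into power series.

-- The coefficients of f (r x); `r = - 1ℚ` gives the substitution x ↦ -x.
scale : ℚ → PowerSeries → PowerSeries
scale r f n = r ^ n * f n

scale-⊛ : ∀ r f g n → (scale r f ⊛ scale r g) n ≡ scale r (f ⊛ g) n
scale-⊛ r f g zero = solve 2
  (λ x y → (con 1ℚ :* x) :* (con 1ℚ :* y) :+ con 0ℚ := con 1ℚ :* (x :* y :+ con 0ℚ))
  refl (f 0) (g 0)
scale-⊛ r f g (suc n) = begin
  1ℚ * f 0 * (r * r ^ n * g (suc n)) + ((scale r f ∘ suc) ⊛ scale r g) n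
    ≡⟨ cong (λ x → 1ℚ * f 0 * (r * r ^ n * g (suc n)) + x)
         (trans (⊛-congʳ (scale r g) (λ k → *-assoc r (r ^ k) (f (suc k))) n)
           (*-⊛ r (scale r (f ∘ suc)) (scale r g) n)) ⟩
  1ℚ * f 0 * (r * r ^ n * g (suc n)) + r * (scale r (f ∘ suc) ⊛ scale r g) n
    ≡⟨ cong (λ x → 1ℚ * f 0 * (r * r ^ n * g (suc n)) + r * x)
         (scale-⊛ r (f ∘ suc) g n) ⟩
  1ℚ * f 0 * (r * r ^ n * g (suc n)) + r * (r ^ n * ((f ∘ suc) ⊛ g) n)
    ≡⟨ solve 5 (λ a r s b c →
         con 1ℚ :* a :* (r :* s :* b) :+ r :* (s :* c) := r :* s :* (a :* b :+ c)) refl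
         (f 0) r (r ^ n) (g (suc n)) (((f ∘ suc) ⊛ g) n) ⟩
  scale r (f ⊛ g) (suc n) ∎

-- The coefficients of f (u x).  Truncating the sum at n is harmless only when u
-- has no constant term.

compose : PowerSeries → PowerSeries → PowerSeries
compose f u n = ∑₀ n λ k → f k * (u ⊛^ k) n

module _ (u : PowerSeries) (u₀ : u 0 ≡ 0ℚ) where

  ⊛-suc : ∀ f n → (u ⊛ f) (suc n) ≡ ((u ∘ suc) ⊛ f) n
  ⊛-suc f n = begin
    u 0 * f (suc n) + ((u ∘ suc) ⊛ f) n
      ≡⟨ cong (λ x → x * f (suc n) + ((u ∘ suc) ⊛ f) n) u₀ ⟩
    0ℚ * f (suc n) + ((u ∘ suc) ⊛ f) n
      ≡⟨ solve 2 (λ x y → con 0ℚ :* x :+ y := y) refl (f (suc n)) _ ⟩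
    ((u ∘ suc) ⊛ f) n ∎

  -- Here u is x times `u ∘ suc`, so uᵏ is divisible by xᵏ. This makes the truncation in `compose`
  -- lossless.
  ⊛^-vanishes : ∀ k {n} → n < k → (u ⊛^ k) n ≡ 0ℚ
  ⊛^-vanishes (suc k) {zero} _ = begin
    u 0 * (u ⊛^ k) 0 + 0ℚ  ≡⟨ cong (λ x → x * (u ⊛^ k) 0 + 0ℚ) u₀ ⟩
    0ℚ * (u ⊛^ k) 0 + 0ℚ   ≡⟨ solve 1 (λ x → con 0ℚ :* x :+ con 0ℚ := con 0ℚ) refl
                                ((u ⊛^ k) 0) ⟩
    0ℚ                     ∎
  ⊛^-vanishes (suc k) {suc n} (s≤s n<k) = begin
    (u ⊛ (u ⊛^ k)) (suc n)        ≡⟨ ⊛-suc (u ⊛^ k) n ⟩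
    ((u ∘ suc) ⊛ (u ⊛^ k)) n      ≡⟨ ⊛-congˡ-≤ (u ∘ suc) n (λ i i≤n →
                                       ⊛^-vanishes k (ℕ.≤-<-trans i≤n n<k)) ⟩
    ((u ∘ suc) ⊛ (λ _ → 0ℚ)) n    ≡⟨ ⊛-zeroʳ (u ∘ suc) n ⟩
    0ℚ                            ∎

  -- Write f (t) = f₀ + t f⁺(t) with f⁺ = `f ∘ suc`. Then f (u) - f₀ = u f⁺(u), and dividing by x
  -- turns u into `u ∘ suc`.
  compose-suc : ∀ f n → compose f u (suc n) ≡ ((u ∘ suc) ⊛ compose (f ∘ suc) u) n
  compose-suc f n = begin
    f 0 * 0ℚ + ∑₀ n (λ k → f (suc k) * (u ⊛ (u ⊛^ k)) (suc n))
      ≡⟨ solve 2 (λ x y → x :* con 0ℚ :+ y := y) refl (f 0) _ ⟩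
    ∑₀ n (λ k → f (suc k) * (u ⊛ (u ⊛^ k)) (suc n))
      ≡⟨ ∑₀-cong n (λ k → cong (f (suc k) *_) (⊛-suc (u ⊛^ k) n)) ⟩
    ∑₀ n (λ k → f (suc k) * ((u ∘ suc) ⊛ (u ⊛^ k)) n)
      ≡⟨ ⊛-∑ {suc n} (u ∘ suc) (λ k → f (suc (toℕ k))) (λ k → u ⊛^ toℕ k) n ⟨
    ((u ∘ suc) ⊛ (λ m → ∑₀ n λ k → f (suc k) * (u ⊛^ k) m)) n
      -- The inner sum runs to `n` whatever `m` is; its terms beyond `m` vanish, which leaves the
      -- bound that `compose` uses.
      ≡⟨ ⊛-congˡ-≤ (u ∘ suc) n (λ m m≤n →
           ∑₀-truncate m≤n (λ k → f (suc k) * (u ⊛^ k) m) λ k m<k →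
           trans (cong (f (suc k) *_) (⊛^-vanishes k m<k)) (*-zeroʳ (f (suc k)))) ⟩
    ((u ∘ suc) ⊛ compose (f ∘ suc) u) n ∎

  compose-linear : ∀ r f g n →
    compose (λ k → r * f k + g k) u n ≡ r * compose f u n + compose g u n
  compose-linear r f g n = begin
    ∑₀ n (λ k → (r * f k + g k) * (u ⊛^ k) n)
      ≡⟨ ∑₀-cong n (λ k →
           solve 4 (λ r x y z → (r :* x :+ y) :* z := r :* (x :* z) :+ y :* z) refl
             r (f k) (g k) ((u ⊛^ k) n)) ⟩
    ∑₀ n (λ k → r * (f k * (u ⊛^ k) n) + g k * (u ⊛^ k) n)
      ≡⟨ ∑₀-distrib-+ n (λ k → r * (f k * (u ⊛^ k) n)) (λ k → g k * (u ⊛^ k) n) ⟩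
    ∑₀ n (λ k → r * (f k * (u ⊛^ k) n)) + compose g u n
      ≡⟨ cong (_+ compose g u n) (sym (*-distribˡ-∑₀ n r λ k → f k * (u ⊛^ k) n)) ⟩
    r * compose f u n + compose g u n ∎

  private
    -- Expands f (u) g (u) as f₀ g (u) + u f⁺(u) g (u). Convolution with `v` asks for the claim
    -- about f⁺ at every index up to `m`, so this is strong induction, with the bound `n` decreasing
    -- structurally.
    compose-⊛-≤ : ∀ f g {n} m → m ≤ n →
      (compose f u ⊛ compose g u) m ≡ compose (f ⊛ g) u m
    compose-⊛-≤ f g zero _ = solve 2
      (λ x y → (x :* con 1ℚ :+ con 0ℚ) :* (y :* con 1ℚ :+ con 0ℚ) :+ con 0ℚ
             := (x :* y :+ con 0ℚ) :* con 1ℚ :+ con 0ℚ) refl (f 0) (g 0)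
    compose-⊛-≤ f g (suc m) (s≤s m≤n) = begin
      (f 0 * 1ℚ + 0ℚ) * C g (suc m) + ((C f ∘ suc) ⊛ C g) m
        ≡⟨ cong₂ (λ x y → (f 0 * 1ℚ + 0ℚ) * x + y) (compose-suc g m)
             (⊛-congʳ (C g) (compose-suc f) m) ⟩
      (f 0 * 1ℚ + 0ℚ) * (v ⊛ C (g ∘ suc)) m + ((v ⊛ C (f ∘ suc)) ⊛ C g) m
        ≡⟨ cong (λ x → (f 0 * 1ℚ + 0ℚ) * (v ⊛ C (g ∘ suc)) m + x)
             (trans (⊛-assoc v (C (f ∘ suc)) (C g) m)
               (⊛-congˡ-≤ v m λ i i≤m → compose-⊛-≤ (f ∘ suc) g i (ℕ.≤-trans i≤m m≤n))) ⟩
      (f 0 * 1ℚ + 0ℚ) * (v ⊛ C (g ∘ suc)) m + (v ⊛ C ((f ∘ suc) ⊛ g)) m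
        ≡⟨ cong (λ x → x * (v ⊛ C (g ∘ suc)) m + (v ⊛ C ((f ∘ suc) ⊛ g)) m)
             (solve 1 (λ x → x :* con 1ℚ :+ con 0ℚ := x) refl (f 0)) ⟩
      f 0 * (v ⊛ C (g ∘ suc)) m + (v ⊛ C ((f ∘ suc) ⊛ g)) m
        ≡⟨ ⊛-linearʳ v (f 0) (C (g ∘ suc)) (C ((f ∘ suc) ⊛ g)) m ⟨
      (v ⊛ (λ k → f 0 * C (g ∘ suc) k + C ((f ∘ suc) ⊛ g) k)) m
        -- `(f ⊛ g) ∘ suc` is definitionally the linear combination that `compose-linear` expects.
        ≡⟨ ⊛-congˡ v (compose-linear (f 0) (g ∘ suc) ((f ∘ suc) ⊛ g)) m ⟨
      (v ⊛ C ((f ⊛ g) ∘ suc)) m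
        ≡⟨ compose-suc (f ⊛ g) m ⟨
      C (f ⊛ g) (suc m) ∎
      where
      C = λ f → compose f u
      v = u ∘ suc

  compose-⊛ : ∀ f g n → (compose f u ⊛ compose g u) n ≡ compose (f ⊛ g) u n
  compose-⊛ f g n = compose-⊛-≤ f g n ℕ.≤-refl

  compose-constant : ∀ f → (∀ k → f (suc k) ≡ 0ℚ) → ∀ n → compose f u n ≡ f 0 * one n
  compose-constant f eq zero = +-identityʳ (f 0 * 1ℚ)
  compose-constant f eq (suc n) = begin
    compose f u (suc n)
      ≡⟨ cong (λ x → f 0 * 0ℚ + x) (∑₀-zero n λ k →
           trans (cong (_* (u ⊛^ suc k) (suc n)) (eq k)) (*-zeroˡ ((u ⊛^ suc k) (suc n)))) ⟩
    f 0 * 0ℚ + 0ℚ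
      ≡⟨ +-identityʳ (f 0 * 0ℚ) ⟩
    f 0 * 0ℚ ∎

-- Natural numbers and reciprocal factorials in ℚ.

ι : ℕ → ℚ
ι n = + n / 1

-- A fraction `p / suc k` is a value of `fromℚᵘ`, so this and the product version reduce identities
-- of fractions to cross-multiplied integer equations, with no reasoning about gcds.
fromℚᵘ-homo-+ : ∀ p q → fromℚᵘ (p ℚᵘ.+ q) ≡ fromℚᵘ p + fromℚᵘ q
fromℚᵘ-homo-+ p q = toℚᵘ-injective
  (ℚᵘ.≃-trans (toℚᵘ-fromℚᵘ (p ℚᵘ.+ q))
    (ℚᵘ.≃-trans (ℚᵘ.≃-sym (ℚᵘ.+-cong (toℚᵘ-fromℚᵘ p) (toℚᵘ-fromℚᵘ q)))
      (ℚᵘ.≃-sym (toℚᵘ-homo-+ (fromℚᵘ p) (fromℚᵘ q)))))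

fromℚᵘ-homo-* : ∀ p q → fromℚᵘ (p ℚᵘ.* q) ≡ fromℚᵘ p * fromℚᵘ q
fromℚᵘ-homo-* p q = toℚᵘ-injective
  (ℚᵘ.≃-trans (toℚᵘ-fromℚᵘ (p ℚᵘ.* q))
    (ℚᵘ.≃-trans (ℚᵘ.≃-sym (ℚᵘ.*-cong (toℚᵘ-fromℚᵘ p) (toℚᵘ-fromℚᵘ q)))
      (ℚᵘ.≃-sym (toℚᵘ-homo-* (fromℚᵘ p) (fromℚᵘ q)))))

ι-+ : ∀ m n → ι (m ℕ.+ n) ≡ ι m + ι n
ι-+ m n = trans
  (fromℚᵘ-cong {x = ℚᵘ.mkℚᵘ (+ (m ℕ.+ n)) 0} {y = ℚᵘ.mkℚᵘ (+ m) 0 ℚᵘ.+ ℚᵘ.mkℚᵘ (+ n) 0}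
    (ℚᵘ.*≡* (cong (ℤ._* + 1)
    (sym (cong₂ ℤ._+_ (ℤ.*-identityʳ (+ m)) (ℤ.*-identityʳ (+ n)))))))
  (fromℚᵘ-homo-+ (ℚᵘ.mkℚᵘ (+ m) 0) (ℚᵘ.mkℚᵘ (+ n) 0))

ι-* : ∀ m n → ι (m ℕ.* n) ≡ ι m * ι n
ι-* m n = trans (cong (_/ 1) (ℤ.pos-* m n))
  (fromℚᵘ-homo-* (ℚᵘ.mkℚᵘ (+ m) 0) (ℚᵘ.mkℚᵘ (+ n) 0))

ι-*-1/ : ∀ n .{{_ : ℕ.NonZero n}} → ι n * (+ 1 / n) ≡ 1ℚ
ι-*-1/ (suc n) = trans
  (sym (fromℚᵘ-homo-* (ℚᵘ.mkℚᵘ (+ suc n) 0) (ℚᵘ.mkℚᵘ (+ 1) n)))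
  (fromℚᵘ-cong {x = ℚᵘ.mkℚᵘ (+ suc n) 0 ℚᵘ.* ℚᵘ.mkℚᵘ (+ 1) n} {y = ℚᵘ.1ℚᵘ}
    (ℚᵘ.*≡* (trans (ℤ.*-identityʳ (+ suc n ℤ.* + 1))
    (trans (ℤ.*-comm (+ suc n) (+ 1)) (cong (+ 1 ℤ.*_)
      (cong +_ (sym (ℕ.*-identityˡ (suc n)))))))))

ι-!-*-1/! : ∀ n → ι (n !) * 1/ n ! ≡ 1ℚ
ι-!-*-1/! n = ι-*-1/ (n !) {{n ℕ.!≢0}}

suc-*-1/suc! : ∀ n → ι (suc n) * 1/ suc n ! ≡ 1/ n !
suc-*-1/suc! n = begin
  x * y              ≡⟨ *-identityʳ (x * y) ⟨
  x * y * 1ℚ         ≡⟨ cong (x * y *_) (ι-!-*-1/! n) ⟨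
  x * y * (a * z)    ≡⟨ solve 4 (λ x y a z → x :* y :* (a :* z) := x :* a :* y :* z) refl
                          x y a z ⟩
  x * a * y * z      ≡⟨ cong (λ w → w * y * z) (ι-* (suc n) (n !)) ⟨
  ι (suc n !) * y * z ≡⟨ cong (_* z) (ι-!-*-1/! (suc n)) ⟩
  1ℚ * z             ≡⟨ *-identityˡ z ⟩
  z                  ∎
  where
  x = ι (suc n)
  y = 1/ suc n !
  a = ι (n !)
  z = 1/ n !

-- The Euler operator and a differential equation.

-- The operator t d/dt. It keeps indices in place, and `θ f (suc n)` is also the coefficient of tⁿ
-- in f′.
θ : PowerSeries → PowerSeries
θ f n = ι n * f n

-- The Leibniz rule: `f k * g (n ∸ k)` carries the weight n = k + (n - k). The induction uses that
-- `θ f ∘ suc` is `f ∘ suc` plus `θ (f ∘ suc)`.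
θ-⊛ : ∀ f g n → θ (f ⊛ g) n ≡ (θ f ⊛ g) n + (f ⊛ θ g) n
θ-⊛ f g zero = solve 2
  (λ x y → con 0ℚ :* (x :* y :+ con 0ℚ)
         := con 0ℚ :* x :* y :+ con 0ℚ :+ (x :* (con 0ℚ :* y) :+ con 0ℚ)) refl (f 0) (g 0)
θ-⊛ f g (suc n) = begin
  ι (suc n) * (f 0 * g (suc n) + F)
    ≡⟨ cong (_* (f 0 * g (suc n) + F)) (ι-+ 1 n) ⟩
  (1ℚ + ι n) * (f 0 * g (suc n) + F)
    ≡⟨ solve 4 (λ m a b c → (con 1ℚ :+ m) :* (a :* b :+ c)
                        := a :* ((con 1ℚ :+ m) :* b) :+ (c :+ m :* c)) refl
         (ι n) (f 0) (g (suc n)) F ⟩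
  f 0 * ((1ℚ + ι n) * g (suc n)) + (F + ι n * F)
    ≡⟨ cong₂ (λ x y → f 0 * (x * g (suc n)) + (F + y)) (sym (ι-+ 1 n)) (θ-⊛ (f ∘ suc) g n) ⟩
  f 0 * θ g (suc n) + (F + ((θ (f ∘ suc) ⊛ g) n + ((f ∘ suc) ⊛ θ g) n))
    -- The zero summand is inserted because the goal contains `θ f 0 * g (suc n)`, and `θ f 0`
    -- computes to `0ℚ * f 0`.
    ≡⟨ solve 5 (λ a b c d e → a :+ (b :+ (c :+ d))
                         := con 0ℚ :* e :+ (b :+ c) :+ (a :+ d)) refl
         (f 0 * θ g (suc n)) F ((θ (f ∘ suc) ⊛ g) n) (((f ∘ suc) ⊛ θ g) n)
         (f 0 * g (suc n)) ⟩
  0ℚ * (f 0 * g (suc n)) + (F + (θ (f ∘ suc) ⊛ g) n)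
    + (f 0 * θ g (suc n) + ((f ∘ suc) ⊛ θ g) n)
    ≡⟨ cong₂ (λ x y → x + y + (f ⊛ θ g) (suc n)) (sym (*-assoc 0ℚ (f 0) (g (suc n)))) (sym θf⁺) ⟩
  θ f 0 * g (suc n) + ((θ f ∘ suc) ⊛ g) n + (f ⊛ θ g) (suc n) ∎
  where
  F = ((f ∘ suc) ⊛ g) n

  θf⁺ : ((θ f ∘ suc) ⊛ g) n ≡ F + (θ (f ∘ suc) ⊛ g) n
  θf⁺ = trans
    (⊛-congʳ g (λ k → trans (cong (_* f (suc k)) (ι-+ 1 k))
      (solve 2 (λ m x → (con 1ℚ :+ m) :* x := x :+ m :* x) refl (ι k) (f (suc k)))) n)
    (⊛-distribʳ-+ (f ∘ suc) (θ (f ∘ suc)) g n)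

-- The coefficient form of (1 + 2t) f′(t) = − s f(t), whose solutions are the
-- multiples of (1 + 2t)^(−s/2).

PowerODE : ℚ → PowerSeries → Set
PowerODE s f = ∀ k → θ f (suc k) ≡ (- (1ℚ + 1ℚ)) * θ f k + (- s) * f k

module _ s f g (ode-f : PowerODE s f) (ode-g : PowerODE (- s) g) where

  private
    -2ℚ = - (1ℚ + 1ℚ)

  -- In (1 + 2t)(f g)′ the contributions -s f g and s f g cancel; this is the coefficient form of (1
  -- + 2t)(f g)′ = 0.
  θ-product-step : ∀ n → θ (f ⊛ g) (suc n) ≡ -2ℚ * θ (f ⊛ g) n
  θ-product-step n = begin
    θ (f ⊛ g) (suc n)
      ≡⟨ θ-⊛ f g (suc n) ⟩
    0ℚ * f 0 * g (suc n) + ((θ f ∘ suc) ⊛ g) n + (f ⊛ θ g) (suc n)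
      -- Each convolution is split at its first term, where `θ` vanishes, so that the differential
      -- equation applies to the rest; for `g` the factors are swapped first.
      ≡⟨ cong₂ (λ x y → 0ℚ * f 0 * g (suc n) + x + y) eq-f
           (trans (⊛-comm f (θ g) (suc n)) (cong (λ x → 0ℚ * g 0 * f (suc n) + x) eq-g)) ⟩
    0ℚ * f 0 * g (suc n) + (-2ℚ * (θ f ⊛ g) n + (- s) * (f ⊛ g) n)
      + (0ℚ * g 0 * f (suc n) + (-2ℚ * (f ⊛ θ g) n + (- (- s)) * (f ⊛ g) n))
      ≡⟨ solve 9 (λ a b c d m s x y z →
           con 0ℚ :* a :* b :+ (m :* x :+ (:- s) :* z)
             :+ (con 0ℚ :* c :* d :+ (m :* y :+ (:- (:- s)) :* z))
           := m :* (x :+ y)) refl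
           (f 0) (g (suc n)) (g 0) (f (suc n)) -2ℚ s ((θ f ⊛ g) n) ((f ⊛ θ g) n) ((f ⊛ g) n) ⟩
    -2ℚ * ((θ f ⊛ g) n + (f ⊛ θ g) n)
      ≡⟨ cong (-2ℚ *_) (θ-⊛ f g n) ⟨
    -2ℚ * θ (f ⊛ g) n ∎
    where
    expand : ∀ r f g → PowerODE r f →
      ((θ f ∘ suc) ⊛ g) n ≡ -2ℚ * (θ f ⊛ g) n + (- r) * (f ⊛ g) n
    expand r f g ode = begin
      ((θ f ∘ suc) ⊛ g) n
        ≡⟨ ⊛-congʳ g ode n ⟩
      ((λ k → -2ℚ * θ f k + (- r) * f k) ⊛ g) n
        ≡⟨ ⊛-distribʳ-+ (λ k → -2ℚ * θ f k) (λ k → (- r) * f k) g n ⟩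
      ((λ k → -2ℚ * θ f k) ⊛ g) n + ((λ k → (- r) * f k) ⊛ g) n
        ≡⟨ cong₂ _+_ (*-⊛ -2ℚ (θ f) g n) (*-⊛ (- r) f g n) ⟩
      -2ℚ * (θ f ⊛ g) n + (- r) * (f ⊛ g) n ∎

    eq-f = expand s f g ode-f

    eq-g : ((θ g ∘ suc) ⊛ f) n ≡ -2ℚ * (f ⊛ θ g) n + (- (- s)) * (f ⊛ g) n
    eq-g = trans (expand (- s) g f ode-g)
      (cong₂ (λ x y → -2ℚ * x + (- (- s)) * y) (⊛-comm (θ g) f n) (⊛-comm g f n))

  θ-product : ∀ n → θ (f ⊛ g) n ≡ 0ℚ
  θ-product zero    = *-zeroˡ ((f ⊛ g) 0)
  θ-product (suc n) = trans (θ-product-step n)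
    (trans (cong (-2ℚ *_) (θ-product n)) (*-zeroʳ -2ℚ))

  product-constant : ∀ n → (f ⊛ g) (suc n) ≡ 0ℚ
  product-constant n = begin
    c                                      ≡⟨ *-identityˡ c ⟨
    1ℚ * c                                 ≡⟨ cong (_* c) (ι-*-1/ (suc n)) ⟨
    ι (suc n) * (+ 1 / suc n) * c          ≡⟨ solve 3 (λ a b c → a :* b :* c := b :* (a :* c))
                                                refl (ι (suc n)) (+ 1 / suc n) c ⟩
    (+ 1 / suc n) * θ (f ⊛ g) (suc n)      ≡⟨ cong ((+ 1 / suc n) *_) (θ-product (suc n)) ⟩
    (+ 1 / suc n) * 0ℚ                     ≡⟨ *-zeroʳ (+ 1 / suc n) ⟩
    0ℚ                                     ∎
    where
    c = (f ⊛ g) (suc n)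

-- Generating functions of the double factorials, and `b ⊛ d`.

-- The series Σ wₖ (-t)ᵏ / k!, which is (1 + 2t)^(-1/2) for `w-b` and -(1 + 2t)^(1/2) for `w-d`.
alternatingEGF : (ℕ → ℚ) → PowerSeries
alternatingEGF w k = (- 1ℚ) ^ k * (1/ k ! * w k)

-- The factor k + 1 cancels against the factorial, and the remaining -(2k + s) splits into the two
-- terms of the equation.
alternatingEGF-ode : ∀ s w → (∀ k → w (suc k) ≡ (ι k + ι k + s) * w k) →
  PowerODE s (alternatingEGF w)
alternatingEGF-ode s w step k = begin
  ι (suc k) * (- 1ℚ * e * (1/ suc k ! * w (suc k)))
    ≡⟨ solve 4 (λ n e i w → n :* (con (- 1ℚ) :* e :* (i :* w))
                        := (:- e) :* (n :* i :* w)) refl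
         (ι (suc k)) e (1/ suc k !) (w (suc k)) ⟩
  (- e) * (ι (suc k) * 1/ suc k ! * w (suc k))
    ≡⟨ cong₂ (λ x y → (- e) * (x * y)) (suc-*-1/suc! k) (step k) ⟩
  (- e) * (1/ k ! * ((ι k + ι k + s) * w k))
    ≡⟨ solve 5 (λ e i n s w → (:- e) :* (i :* ((n :+ n :+ s) :* w))
         := (:- (con 1ℚ :+ con 1ℚ)) :* (n :* (e :* (i :* w))) :+ (:- s) :* (e :* (i :* w))) refl
         e (1/ k !) (ι k) s (w k) ⟩
  (- (1ℚ + 1ℚ)) * θ (alternatingEGF w) k + (- s) * alternatingEGF w k ∎
  where
  e = (- 1ℚ) ^ k

-- The n! in S(n,k) cancels the outer 1/n!, and what remains is the coefficient of a series in eˣ -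
-- 1, up to the sign (-1)ⁿ.
stirling-sum : ∀ w n →
  (- 1ℚ) ^ n * 1/ n ! * ∑₀ n (λ k → (- 1ℚ) ^ k * S n k * w k)
    ≡ scale (- 1ℚ) (compose (alternatingEGF w) (exp ⊖ one)) n
stirling-sum w n = begin
  e * i * ∑₀ n (λ k → (- 1ℚ) ^ k * S n k * w k)
    ≡⟨ cong (e * i *_) (∑₀-cong n λ k → solve 5
         (λ e f p i w → e :* (f :* (p :* i)) :* w := f :* (e :* (i :* w) :* p)) refl
         ((- 1ℚ) ^ k) (ι (n !)) (((exp ⊖ one) ⊛^ k) n) (1/ k !) (w k)) ⟩
  e * i * ∑₀ n (λ k → ι (n !) * (alternatingEGF w k * ((exp ⊖ one) ⊛^ k) n))
    ≡⟨ cong (e * i *_) (*-distribˡ-∑₀ n (ι (n !))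
         λ k → alternatingEGF w k * ((exp ⊖ one) ⊛^ k) n) ⟨
  e * i * (ι (n !) * C)
    ≡⟨ solve 4 (λ e i f c → e :* i :* (f :* c) := f :* i :* (e :* c)) refl e i (ι (n !)) C ⟩
  ι (n !) * i * (e * C)
    ≡⟨ cong (_* (e * C)) (ι-!-*-1/! n) ⟩
  1ℚ * (e * C)
    ≡⟨ *-identityˡ (e * C) ⟩
  e * C ∎
  where
  e = (- 1ℚ) ^ n
  i = 1/ n !
  C = compose (alternatingEGF w) (exp ⊖ one) n

w-b w-d : ℕ → ℚ
w-b k = [2 + k -1]!!
w-d k = [2 + k ℤ.- + 1 -1]!!

ι-odd : ∀ k → ι (2 ℕ.* k ℕ.+ 1) ≡ ι k + ι k + 1ℚ
ι-odd k = begin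
  ι (2 ℕ.* k ℕ.+ 1)         ≡⟨ ι-+ (2 ℕ.* k) 1 ⟩
  ι (k ℕ.+ (k ℕ.+ 0)) + 1ℚ  ≡⟨ cong (λ m → ι (k ℕ.+ m) + 1ℚ) (ℕ.+-identityʳ k) ⟩
  ι (k ℕ.+ k) + 1ℚ          ≡⟨ cong (_+ 1ℚ) (ι-+ k k) ⟩
  ι k + ι k + 1ℚ            ∎

w-b-step : ∀ k → w-b (suc k) ≡ (ι k + ι k + 1ℚ) * w-b k
w-b-step k = begin
  ι (oddProduct k ℕ.* (2 ℕ.* k ℕ.+ 1))    ≡⟨ ι-* (oddProduct k) (2 ℕ.* k ℕ.+ 1) ⟩
  w-b k * ι (2 ℕ.* k ℕ.+ 1)               ≡⟨ *-comm (w-b k) _ ⟩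
  ι (2 ℕ.* k ℕ.+ 1) * w-b k               ≡⟨ cong (_* w-b k) (ι-odd k) ⟩
  (ι k + ι k + 1ℚ) * w-b k                ∎

w-d-step : ∀ k → w-d (suc k) ≡ (ι k + ι k + - 1ℚ) * w-d k
-- The convention (-3)!! = -1 enters here: it extends the recursion down to (-1)!! = 1.
w-d-step zero = refl
w-d-step (suc k) = trans (w-b-step k) (cong (_* w-b k) (begin
  ι k + ι k + 1ℚ
    ≡⟨ solve 1 (λ x → x :+ x :+ con 1ℚ
                   := con 1ℚ :+ x :+ (con 1ℚ :+ x) :+ con (- 1ℚ)) refl (ι k) ⟩
  1ℚ + ι k + (1ℚ + ι k) + - 1ℚ
    ≡⟨ cong (λ x → x + x + - 1ℚ) (ι-+ 1 k) ⟨
  ι (suc k) + ι (suc k) + - 1ℚ ∎))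

b⊛d : ∀ n → (b ⊛ d) n ≡ (- (+ 1 / 4)) * one n
b⊛d n = begin
  (b ⊛ d) n
    ≡⟨ trans (⊛-congʳ d b≗ n) (⊛-congˡ (λ k → ¼ * scale (- 1ℚ) (C w-b) k) (stirling-sum w-d) n) ⟩
  ((λ k → ¼ * scale (- 1ℚ) (C w-b) k) ⊛ scale (- 1ℚ) (C w-d)) n
    ≡⟨ *-⊛ ¼ (scale (- 1ℚ) (C w-b)) (scale (- 1ℚ) (C w-d)) n ⟩
  ¼ * (scale (- 1ℚ) (C w-b) ⊛ scale (- 1ℚ) (C w-d)) n
    ≡⟨ cong (¼ *_) (scale-⊛ (- 1ℚ) (C w-b) (C w-d) n) ⟩
  ¼ * ((- 1ℚ) ^ n * (C w-b ⊛ C w-d) n)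
    ≡⟨ cong (λ x → ¼ * ((- 1ℚ) ^ n * x)) (trans
         (compose-⊛ (exp ⊖ one) refl (alternatingEGF w-b) (alternatingEGF w-d) n)
         (compose-constant (exp ⊖ one) refl (alternatingEGF w-b ⊛ alternatingEGF w-d)
           (product-constant 1ℚ (alternatingEGF w-b) (alternatingEGF w-d)
           (alternatingEGF-ode 1ℚ w-b w-b-step) (alternatingEGF-ode (- 1ℚ) w-d w-d-step)) n)) ⟩
  ¼ * ((- 1ℚ) ^ n * (- 1ℚ * one n))
    ≡⟨ cong (¼ *_) (evaluate n) ⟩
  ¼ * (- 1ℚ * one n)
    ≡⟨ *-assoc ¼ (- 1ℚ) (one n) ⟨
  (- ¼) * one n ∎
  where
  ¼ = + 1 / 4
  C = λ w → compose (alternatingEGF w) (exp ⊖ one)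

  b≗ : b ≗ λ k → ¼ * scale (- 1ℚ) (C w-b) k
  b≗ k = trans
    (*-assoc ¼ ((- 1ℚ) ^ k * 1/ k !) _)
    (cong (¼ *_) (stirling-sum w-b k))

  evaluate : ∀ n → (- 1ℚ) ^ n * (- 1ℚ * one n) ≡ - 1ℚ * one n
  evaluate zero    = refl
  evaluate (suc n) = *-zeroʳ ((- 1ℚ) ^ suc n)

-- Toeplitz-Hessenberg determinants.

det-cong : ∀ {n} {A A′ : Matrix n} → (∀ i j → A i j ≡ A′ i j) → det A ≡ det A′
det-cong {zero}  eq = refl
det-cong {suc n} eq = sum-cong-≗ {suc n} λ j → cong₂ (λ x y → (- 1ℚ) ^ toℕ j * x * y)
  (eq zero j) (det-cong λ i k → eq (suc i) (punchIn j k))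

-- Recursion along diagonals, instead of a subtraction of indices, makes the matrix without its
-- first row and column definitionally the smaller Toeplitz matrix.
hessenberg : PowerSeries → ℕ → ℕ → ℚ
hessenberg a i       zero          = a (suc i)
hessenberg a zero    (suc zero)    = a 0
hessenberg a zero    (suc (suc j)) = 0ℚ
hessenberg a (suc i) (suc j)       = hessenberg a i j

toeplitz : PowerSeries → ∀ n → Matrix n
toeplitz a n i j = hessenberg a (toℕ i) (toℕ j)

-- Removing the first row and the second column of a Toeplitz–Hessenberg matrix
-- shifts its first column; with an arbitrary first column the class of
-- matrices is closed under the Laplace expansion.

bordered : PowerSeries → PowerSeries → ∀ n → Matrix n
bordered a c n i zero    = c (toℕ i)
bordered a c n i (suc j) = hessenberg a (toℕ i) (suc (toℕ j))

toeplitz-bordered : ∀ a n → det (toeplitz a n) ≡ det (bordered a (a ∘ suc) n)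
toeplitz-bordered a n = det-cong {n} λ where
  i zero    → refl
  i (suc j) → refl

det-bordered-1 : ∀ a c → det (bordered a c 1) ≡ c 0
det-bordered-1 a c =
  solve 1 (λ x → con 1ℚ :* x :* con 1ℚ :+ con 0ℚ := x) refl (c 0)

-- Beyond `c 0` and `a 0` the first row is zero, so only two minors survive.
det-bordered-suc : ∀ a c n → det (bordered a c (suc (suc n)))
  ≡ c 0 * det (toeplitz a (suc n)) + (- a 0) * det (bordered a (c ∘ suc) (suc n))
det-bordered-suc a c n = begin
  1ℚ * c 0 * minor zero + ((- 1ℚ) * 1ℚ * a 0 * minor (suc zero)
    + ∑[ j < n ] ((- 1ℚ) ^ suc (suc (toℕ j)) * 0ℚ * minor (suc (suc j))))
    ≡⟨ cong₂ (λ x y → 1ℚ * c 0 * minor zero + ((- 1ℚ) * 1ℚ * a 0 * x + y))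
         (det-cong shifted)
         (trans (sum-cong-≗ {n} λ j →
            solve 2 (λ x y → x :* con 0ℚ :* y := con 0ℚ) refl
              ((- 1ℚ) ^ suc (suc (toℕ j))) (minor (suc (suc j))))
           (sum-replicate-zero n)) ⟩
  1ℚ * c 0 * det (toeplitz a (suc n))
    + ((- 1ℚ) * 1ℚ * a 0 * det (bordered a (c ∘ suc) (suc n)) + 0ℚ)
    ≡⟨ solve 4 (λ x y z w →
         con 1ℚ :* x :* y :+ (con (- 1ℚ) :* con 1ℚ :* z :* w :+ con 0ℚ)
           := x :* y :+ (:- z) :* w) refl
         (c 0) (det (toeplitz a (suc n))) (a 0) (det (bordered a (c ∘ suc) (suc n))) ⟩
  c 0 * det (toeplitz a (suc n)) + (- a 0) * det (bordered a (c ∘ suc) (suc n)) ∎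
  where
  minor : Fin (suc (suc n)) → ℚ
  minor j = det λ i k → bordered a c (suc (suc n)) (suc i) (punchIn j k)

  shifted : ∀ i k → bordered a c (suc (suc n)) (suc i) (punchIn (suc zero) k)
                      ≡ bordered a (c ∘ suc) (suc n) i k
  shifted i zero    = refl
  shifted i (suc k) = refl

module _ a e (inverse : ∀ n → (a ⊛ e) n ≡ one n) where

  private
    s = - a 0

  a₀e₀ : a 0 * e 0 ≡ 1ℚ
  a₀e₀ = trans (sym (+-identityʳ (a 0 * e 0))) (inverse 0)

  -- Given the smaller Toeplitz determinants, the Laplace expansion matches the first-term recursion
  -- of `c ⊛ e`. The column `c` stays general because the induction shifts it.
  det-bordered-⊛ : ∀ n →
    (∀ m → m ≤ n → det (toeplitz a m) ≡ - (s ^ suc m * e m)) →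
    ∀ c → det (bordered a c (suc n)) ≡ - (s ^ suc n * (c ⊛ e) n)
  det-bordered-⊛ zero _ c = begin
    det (bordered a c 1)                ≡⟨ det-bordered-1 a c ⟩
    c 0                                 ≡⟨ *-identityʳ (c 0) ⟨
    c 0 * 1ℚ                            ≡⟨ cong (c 0 *_) a₀e₀ ⟨
    c 0 * (a 0 * e 0)
      ≡⟨ solve 3 (λ c a e → c :* (a :* e)
                       := :- ((:- a) :* con 1ℚ :* (c :* e :+ con 0ℚ))) refl (c 0) (a 0) (e 0) ⟩
    - (s * 1ℚ * (c 0 * e 0 + 0ℚ))       ∎
  det-bordered-⊛ (suc n) eq c = begin
    det (bordered a c (suc (suc n)))
      ≡⟨ det-bordered-suc a c n ⟩
    c 0 * det (toeplitz a (suc n)) + s * det (bordered a (c ∘ suc) (suc n))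
      ≡⟨ cong₂ (λ x y → c 0 * x + s * y) (eq (suc n) ℕ.≤-refl)
           (det-bordered-⊛ n (λ m m≤n → eq m (ℕ.m≤n⇒m≤1+n m≤n)) (c ∘ suc)) ⟩
    c 0 * - (s * s ^ suc n * e (suc n)) + s * - (s ^ suc n * ((c ∘ suc) ⊛ e) n)
      ≡⟨ solve 5 (λ c s t e f → c :* (:- (s :* t :* e)) :+ s :* (:- (t :* f))
                             := :- (s :* t :* (c :* e :+ f))) refl
           (c 0) s (s ^ suc n) (e (suc n)) (((c ∘ suc) ⊛ e) n) ⟩
    - (s * s ^ suc n * (c ⊛ e) (suc n)) ∎

  -- Strong induction with bound `n`, since the bordered determinant uses all smaller Toeplitz ones.
  det-toeplitz-≤ : ∀ n m → m ≤ n → det (toeplitz a m) ≡ - (s ^ suc m * e m)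
  det-toeplitz-≤ n zero _ = trans (sym a₀e₀)
    (solve 2 (λ a e → a :* e := :- ((:- a) :* con 1ℚ :* e)) refl (a 0) (e 0))
  det-toeplitz-≤ (suc n) (suc m) (s≤s m≤n) = begin
    det (toeplitz a (suc m))
      ≡⟨ toeplitz-bordered a (suc m) ⟩
    det (bordered a (a ∘ suc) (suc m))
      ≡⟨ det-bordered-⊛ m (λ k k≤m → det-toeplitz-≤ n k (ℕ.≤-trans k≤m m≤n)) (a ∘ suc) ⟩
    - (s ^ suc m * ((a ∘ suc) ⊛ e) m)
      -- Adding and subtracting `a 0 * e (suc m)` completes the convolution to `a ⊛ e`, which
      -- vanishes in positive degree.
      ≡⟨ solve 4 (λ a t e f → :- (t :* f)
                  := :- (t :* ((a :* e :+ f) :+ (:- a) :* e))) refl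
           (a 0) (s ^ suc m) (e (suc m)) (((a ∘ suc) ⊛ e) m) ⟩
    - (s ^ suc m * ((a ⊛ e) (suc m) + s * e (suc m)))
      ≡⟨ cong (λ x → - (s ^ suc m * (x + s * e (suc m)))) (inverse (suc m)) ⟩
    - (s ^ suc m * (0ℚ + s * e (suc m)))
      ≡⟨ solve 3 (λ t s e → :- (t :* (con 0ℚ :+ s :* e)) := :- (s :* t :* e)) refl
           (s ^ suc m) s (e (suc m)) ⟩
    - (s ^ suc (suc m) * e (suc m)) ∎

  det-toeplitz : ∀ n → det (toeplitz a n) ≡ - (s ^ suc n * e n)
  det-toeplitz n = det-toeplitz-≤ n n ℕ.≤-refl

-- The determinants of `D` and `B`.

D-hessenberg : ∀ i j →
  (if j ≤ᵇ i then d (suc (i ∸ j)) else if j ≡ᵇ suc i then - 1ℚ else 0ℚ) ≡ hessenberg d i j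
D-hessenberg i             zero          = refl
D-hessenberg zero          (suc zero)    = refl
-- The superdiagonal entry -1 is `d 0`, by computation.
D-hessenberg zero          (suc (suc j)) = refl
D-hessenberg (suc i)       (suc zero)    = refl
D-hessenberg (suc i)       (suc (suc j)) = D-hessenberg i (suc j)

B-hessenberg : ∀ i j →
  (if j ≤ᵇ suc i then b (suc i ∸ j) else 0ℚ) ≡ hessenberg b i j
B-hessenberg i             zero          = refl
B-hessenberg zero          (suc zero)    = refl
B-hessenberg zero          (suc (suc j)) = refl
B-hessenberg (suc i)       (suc zero)    = refl
B-hessenberg (suc i)       (suc (suc j)) = B-hessenberg i (suc j)

d⊛-4b : ∀ n → (d ⊛ (λ k → - (+ 4 / 1) * b k)) n ≡ one n
d⊛-4b n = begin
  (d ⊛ (λ k → - (+ 4 / 1) * b k)) n      ≡⟨ ⊛-* (- (+ 4 / 1)) d b n ⟩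
  - (+ 4 / 1) * (d ⊛ b) n                ≡⟨ cong (- (+ 4 / 1) *_)
                                              (trans (⊛-comm d b n) (b⊛d n)) ⟩
  - (+ 4 / 1) * (- (+ 1 / 4) * one n)    ≡⟨ *-assoc (- (+ 4 / 1)) (- (+ 1 / 4)) (one n) ⟨
  1ℚ * one n                             ≡⟨ *-identityˡ (one n) ⟩
  one n                                  ∎

b⊛-4d : ∀ n → (b ⊛ (λ k → - (+ 4 / 1) * d k)) n ≡ one n
b⊛-4d n = begin
  (b ⊛ (λ k → - (+ 4 / 1) * d k)) n      ≡⟨ ⊛-* (- (+ 4 / 1)) b d n ⟩
  - (+ 4 / 1) * (b ⊛ d) n                ≡⟨ cong (- (+ 4 / 1) *_) (b⊛d n) ⟩
  - (+ 4 / 1) * (- (+ 1 / 4) * one n)    ≡⟨ *-assoc (- (+ 4 / 1)) (- (+ 1 / 4)) (one n) ⟨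
  1ℚ * one n                             ≡⟨ *-identityˡ (one n) ⟩
  one n                                  ∎

1^ : ∀ n → 1ℚ ^ n ≡ 1ℚ
1^ zero    = refl
1^ (suc n) = trans (*-identityˡ (1ℚ ^ n)) (1^ n)

-- Serves the final cancellation, where (-1) · 4 · (-1/4) = 1.
^-cancel : ∀ x y z → x * y * z ≡ 1ℚ → ∀ n → x ^ n * y ^ n * z ^ n ≡ 1ℚ
^-cancel x y z eq zero    = refl
^-cancel x y z eq (suc n) = begin
  x * x ^ n * (y * y ^ n) * (z * z ^ n)
    ≡⟨ solve 6 (λ x y z p q r → x :* p :* (y :* q) :* (z :* r) := x :* y :* z :* (p :* q :* r))
         refl x y z (x ^ n) (y ^ n) (z ^ n) ⟩
  x * y * z * (x ^ n * y ^ n * z ^ n)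
    ≡⟨ cong₂ _*_ eq (^-cancel x y z eq n) ⟩
  1ℚ ∎

det-D : ∀ n → det (D n) ≡ + 4 / 1 * b n
det-D n = begin
  det (D n)                            ≡⟨ det-cong {n} (λ i j → D-hessenberg (toℕ i) (toℕ j)) ⟩
  det (toeplitz d n)                   ≡⟨ det-toeplitz d (λ k → - (+ 4 / 1) * b k) d⊛-4b n ⟩
  -- The base of the power is `- d 0`, which computes to `1ℚ`; for `B` it is `- b 0`, that is -1/4.
  - (1ℚ ^ suc n * (- (+ 4 / 1) * b n)) ≡⟨ cong (λ x → - (x * (- (+ 4 / 1) * b n))) (1^ (suc n)) ⟩
  - (1ℚ * (- (+ 4 / 1) * b n))         ≡⟨ solve 1 (λ x → :- (con 1ℚ :* (con (- (+ 4 / 1)) :* x))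
                                            := con (+ 4 / 1) :* x) refl (b n) ⟩
  + 4 / 1 * b n                        ∎

det-B : ∀ n → det (B n) ≡ - ((- (+ 1 / 4)) ^ suc n * (- (+ 4 / 1) * d n))
det-B n = trans (det-cong {n} λ i j → B-hessenberg (toℕ i) (toℕ j))
  (det-toeplitz b (λ k → - (+ 4 / 1) * d k) b⊛-4d n)

theorem6p5 : (n : ℕ) → 1 ≤ n →
    (b n ≡ (+ 1 / 4) * det (D n)) ×
    (d n ≡ (- 1ℚ) ^ (n ∸ 1) * (+ 4 / 1) ^ n * det (B n))
theorem6p5 (suc n) _ = b-det , d-det
  where
  e = (- 1ℚ) ^ n
  p = (+ 4 / 1) ^ n
  q = (- (+ 1 / 4)) ^ n

  b-det = sym (begin
    + 1 / 4 * det (D (suc n))            ≡⟨ cong (+ 1 / 4 *_) (det-D (suc n)) ⟩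
    + 1 / 4 * (+ 4 / 1 * b (suc n))      ≡⟨ *-assoc (+ 1 / 4) (+ 4 / 1) (b (suc n)) ⟨
    1ℚ * b (suc n)                       ≡⟨ *-identityˡ (b (suc n)) ⟩
    b (suc n)                            ∎)

  d-det = sym (begin
    e * (+ 4 / 1 * p) * det (B (suc n))
      ≡⟨ cong (e * (+ 4 / 1 * p) *_) (det-B (suc n)) ⟩
    e * (+ 4 / 1 * p) * - (- (+ 1 / 4) * (- (+ 1 / 4) * q) * (- (+ 4 / 1) * d (suc n)))
      -- The constants outside the nth powers multiply to 4 · (-(1/16 · (-4))) = 1.
      ≡⟨ solve 4 (λ e p q x →
           e :* (con (+ 4 / 1) :* p)
             :* (:- (con (- (+ 1 / 4)) :* (con (- (+ 1 / 4)) :* q) :* (con (- (+ 4 / 1)) :* x)))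
           := e :* p :* q :* x) refl e p q (d (suc n)) ⟩
    e * p * q * d (suc n)
      ≡⟨ cong (_* d (suc n)) (^-cancel (- 1ℚ) (+ 4 / 1) (- (+ 1 / 4)) refl n) ⟩
    1ℚ * d (suc n)
      ≡⟨ *-identityˡ (d (suc n)) ⟩
    d (suc n) ∎)
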